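{- For all integers $n,k \geq 2$, every tournament on $n$ vertices contains (as a subgraph) the $k$-th power of a directed path of length $\ell$ for some $\ell \geq \frac{n}{2^{6k+7}}$. Equivalently, $\ell(n,k) \geq \frac{n}{2^{6k+7}}$.
   Context: For integers $\ell \geq 0$ and $k \geq 1$, the $k$-th power $P_\ell^k$ of a directed path of length $\ell$ is the directed graph with vertex set $\{0,1,\ldots,\ell\}$ whose directed edges are exactly the pairs $(i,j)$ with $i < j \leq i+k$. A tournament contains $P_\ell^k$ if there is an injective map $\phi$ from $\{0,\ldots,\ell\}$ to its vertex set such that for every edge $(i,j)$ of $P_\ell^k$ the tournament has the edge oriented from $\phi(i)$ to $\phi(j)$. $\ell(n,k)$ denotes the largest $\ell$ such that every tournament on $n$ vertices contains $P_\ell^k$. -}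

module Defs where

open import Data.Nat using (ℕ; suc; _+_; _<_; _≤_)
open import Data.Fin using (Fin; toℕ)
open import Data.Bool using (Bool; true; false; T)
open import Data.Sum using (_⊎_)
open import Relation.Binary.PropositionalEquality using (_≡_; _≢_)
open import Relation.Nullary using (¬_)
open import Function.Definitions using (Injective)
open import Data.Product using (Σ; _×_)

record Tournament (n : ℕ) : Set where
  field
    adj         : Fin n → Fin n → Bool
    irreflexive : ∀ u → adj u u ≡ false
    complete    : ∀ u v → u ≢ v → T (adj u v) ⊎ T (adj v u)
    asymmetric  : ∀ u v → T (adj u v) → ¬ T (adj v u)

-- P_ℓ^k: vertex set {0,…,ℓ} = Fin (suc ℓ), edges (i,j) with i < j ≤ i + k.
-- The tournament contains P_ℓ^k if there is an injective φ mapping every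
-- such edge (i,j) to an edge oriented from φ i to φ j.
ContainsPathPower : {n : ℕ} → Tournament n → (ℓ k : ℕ) → Set
ContainsPathPower {n} G ℓ k =
  Σ (Fin (suc ℓ) → Fin n) λ φ →
    Injective _≡_ _≡_ φ ×
    (∀ (i j : Fin (suc ℓ)) → toℕ i < toℕ j → toℕ j ≤ toℕ i + k →
       T (Tournament.adj G (φ i) (φ j)))

-- In a median order every vertex dominates at least half of each interval following it.
-- Walk along such an order in windows of length 4D, keeping a set A of a vertices inside an
-- interval of length 2D; then each vertex of A has at least D out-neighbours in the next
-- window J.  Dependent random choice (derandomised) yields a subset of A of size 2^k all of
-- whose k-subsets have more than 2a common out-neighbours in J.  It contains a transitive
-- k-set, which becomes the next block of the path; one half of J contains a of its common
-- out-neighbours, and these form the next set A.  With a = 2·8^k and D = 4a² each window of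
-- length 4D = 2^(6k+6) contributes k vertices.

module Submission where

open import Defs
open import Data.Bool using (T; true; false)
open import Data.Bool.Properties using (T?)
open import Data.Fin using (Fin; zero; suc; toℕ)
open import Data.List using (List; []; _∷_; _++_; map; length; filter; cartesianProductWith; take; drop; lookup; allFin)
open import Data.List.Properties
  using (length-map; length-++; length-++-≤ʳ; length-filter; length-take; length-drop; length-tabulate;
         filter-++; filter-all; take++drop≡id; take-[]; ++-assoc; ++-identityʳ)
open import Data.List.Membership.Propositional using (_∈_)
open import Data.List.Membership.Propositional.Properties
  using (∈-length; ∈-lookup; ∈-filter⁺; ∈-filter⁻; ∈-++⁺ˡ; ∈-++⁺ʳ; ∈-++⁻; ∈-cartesianProductWith⁺)
open import Data.List.Relation.Binary.Permutation.Propositional using (_↭_; ↭-refl; ↭-sym; ↭-trans; prep; ↭⇒↭ₛ)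
open import Data.List.Relation.Binary.Permutation.Propositional.Properties using (filter-↭; ↭-length; shift)
import Data.List.Relation.Binary.Permutation.Setoid.Properties as Permutationₛ
open import Data.List.Relation.Binary.Subset.Propositional using (_⊆_)
open import Data.List.Relation.Binary.Subset.Propositional.Properties using (filter-⊆)
open import Data.List.Relation.Unary.All as All using (All; []; _∷_; all?)
import Data.List.Relation.Unary.All.Properties as All
open import Data.List.Relation.Unary.AllPairs as AllPairs using (AllPairs; []; _∷_)
import Data.List.Relation.Unary.AllPairs.Properties as AllPairs
open import Data.List.Relation.Unary.Any using (here; there)
open import Data.List.Relation.Unary.Unique.Propositional using (Unique)
import Data.List.Relation.Unary.Unique.Propositional.Properties as Unique
open import Data.Nat using (ℕ; zero; suc; _≤_; _<_; _*_; _+_; _^_; _≤?_; z≤n; s≤s; >-nonZero)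
open import Data.Nat.DivMod using (_/_; _%_; m≡m%n+[m/n]*n; m%n<n; m/n*n≤m)
open import Data.Nat.ListAction using (sum)
open import Data.Nat.Properties
open import Algebra.Properties.CommutativeSemigroup +-commutativeSemigroup using (x∙yz≈y∙xz)
open import Data.Nat.Tactic.RingSolver using (solve-∀)
open import Data.Product using (Σ; ∃; _×_; _,_; proj₁; proj₂)
open import Data.Sum using (_⊎_; inj₁; inj₂; [_,_]′)
open import Data.Unit using (⊤; tt)
open import Function using (_∘_; Injective)
open import Level using (0ℓ)
open import Relation.Binary using (REL)
import Relation.Binary as B
open import Relation.Binary.PropositionalEquality using (_≡_; _≢_; refl; cong; cong₂; sym; trans; subst)
open import Relation.Binary.PropositionalEquality.Properties using (setoid)
open import Relation.Nullary using (¬_; does; yes; no; contradiction)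
open import Relation.Unary using (Pred; Decidable)

private variable
  X Y Z : Set

-- Double counting and averaging over finite lists.

count : {P : Pred X 0ℓ} → Decidable P → List X → ℕ
count P? xs = length (filter P? xs)

private
  sum-zeros : (xs : List X) → sum (map (λ _ → 0) xs) ≡ 0
  sum-zeros []       = refl
  sum-zeros (x ∷ xs) = sum-zeros xs

module _ {R : REL X Y 0ℓ} (R? : B.Decidable R) where

  sum-count-∷ : ∀ y ys xs → sum (map (λ x → count (R? x) (y ∷ ys)) xs)
    ≡ count (λ x → R? x y) xs + sum (map (λ x → count (R? x) ys) xs)
  sum-count-∷ y ys []       = refl
  sum-count-∷ y ys (x ∷ xs)
    rewrite sum-count-∷ y ys xs
    with does (R? x y)
  ... | true  = cong suc (x∙yz≈y∙xz (count (R? x) ys) (count (λ x → R? x y) xs) _)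
  ... | false = x∙yz≈y∙xz (count (R? x) ys) (count (λ x → R? x y) xs) _

  double-count : ∀ xs ys → sum (map (λ y → count (λ x → R? x y) xs) ys)
                         ≡ sum (map (λ x → count (R? x) ys) xs)
  double-count xs []       = sym (sum-zeros xs)
  double-count xs (y ∷ ys) = trans (cong (count (λ x → R? x y) xs +_) (double-count xs ys))
                                   (sym (sum-count-∷ y ys xs))

  -- Lets the samples be fixed one at a time: after `y` is chosen, the remaining samples act on the
  -- neighbours of `y` only.
  count-all-∷ : ∀ y ys xs → count (λ x → all? (R? x) (y ∷ ys)) xs
                          ≡ count (λ x → all? (R? x) ys) (filter (λ x → R? x y) xs)
  count-all-∷ y ys []       = refl
  count-all-∷ y ys (x ∷ xs) with does (R? x y)
  ... | false = count-all-∷ y ys xs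
  ... | true  with does (all? (R? x) ys)
  ...   | true  = cong suc (count-all-∷ y ys xs)
  ...   | false = count-all-∷ y ys xs

  count-all-[] : ∀ xs → count (λ x → all? (R? x) []) xs ≡ length xs
  count-all-[] xs = cong length (filter-all (λ x → all? (R? x) []) {xs} (All.tabulate λ _ → []))

sum-≥ : ∀ {c} (f : X → ℕ) xs → All (λ x → c ≤ f x) xs → length xs * c ≤ sum (map f xs)
sum-≥ f []       []       = z≤n
sum-≥ f (x ∷ xs) (p ∷ ps) = +-mono-≤ p (sum-≥ f xs ps)

sum-≤ : ∀ {c} (f : X → ℕ) xs → All (λ x → f x ≤ c) xs → sum (map f xs) ≤ length xs * c
sum-≤ f []       []       = z≤n
sum-≤ f (x ∷ xs) (p ∷ ps) = +-mono-≤ p (sum-≤ f xs ps)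

-- If the conclusion failed at every entry, summing the failures over the nonempty `xs` would
-- contradict the hypothesis. Keeping `v * f x` on the left avoids subtraction in the potential
-- `u * g x - v * f x`.
weighted-pigeonhole : ∀ (f g : X → ℕ) v u c xs → 0 < length xs →
  v * sum (map f xs) + length xs * c ≤ u * sum (map g xs) →
  ∃ λ x → v * f x + c ≤ u * g x
weighted-pigeonhole f g v u c (x ∷ xs) _ le with v * f x + c ≤? u * g x
... | yes p = x , p
weighted-pigeonhole f g v u c (x ∷ []) _ le | no ¬p = contradiction (simpl le) ¬p
  where
  simpl : v * (f x + 0) + (c + 0) ≤ u * (g x + 0) → v * f x + c ≤ u * g x
  simpl rewrite +-identityʳ (f x) | +-identityʳ c | +-identityʳ (g x) = λ z → z
weighted-pigeonhole f g v u c (x ∷ xs@(_ ∷ _)) _ le | no ¬p =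
  weighted-pigeonhole f g v u c xs (s≤s z≤n) (+-cancelˡ-≤ (v * f x + c) _ _ (begin
    v * f x + c + (v * F + length xs * c)  ≡⟨ regroup v (f x) c F (length xs * c) ⟩
    v * (f x + F) + (c + length xs * c)    ≤⟨ le ⟩
    u * (g x + G)                          ≡⟨ *-distribˡ-+ u (g x) G ⟩
    u * g x + u * G                        ≤⟨ +-monoˡ-≤ (u * G) (≰⇒≥ ¬p) ⟩
    v * f x + c + u * G                    ∎))
  where
  open ≤-Reasoning
  F = sum (map f xs)
  G = sum (map g xs)
  regroup : ∀ v a c b d → v * a + c + (v * b + d) ≡ v * (a + b) + (c + d)
  regroup = solve-∀

-- Dependent random choice.

module _ {R : REL X Y 0ℓ} (R? : B.Decidable R) {S : REL Z Y 0ℓ} (S? : B.Decidable S)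
         (ys : List Y) (ys≢[] : 0 < length ys) (D m w c : ℕ) where

  -- Dependent random choice by conditional expectations: restricting to the neighbours of a
  -- random y ∈ ys scales |zs| on average by at most m / |ys| and |xs| by at least D / |ys|.
  dependent-choice : ∀ t xs zs →
    All (λ x → D ≤ count (R? x) ys) xs → All (λ z → count (S? z) ys ≤ m) zs →
    w * m ^ t * length zs + c * length ys ^ t ≤ D ^ t * length xs →
    ∃ λ cs → w * count (λ z → all? (S? z) cs) zs + c ≤ count (λ x → all? (R? x) cs) xs
  dependent-choice zero xs zs _ _ le = [] , (begin
    w * count (λ z → all? (S? z) []) zs + c  ≡⟨ cong (λ l → w * l + c) (count-all-[] S? zs) ⟩
    w * length zs + c                        ≡⟨ units w (length zs) c ⟩
    w * 1 * length zs + c * 1                ≤⟨ le ⟩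
    1 * length xs                            ≡⟨ *-identityˡ _ ⟩
    length xs                                ≡⟨ count-all-[] R? xs ⟨
    count (λ x → all? (R? x) []) xs          ∎)
    where
    open ≤-Reasoning
    units : ∀ w z c → w * z + c ≡ w * 1 * z + c * 1
    units = solve-∀
  dependent-choice (suc t) xs zs dR dS le =
    let y , q = weighted-pigeonhole (λ y → count (λ z → S? z y) zs) (λ y → count (λ x → R? x y) xs)
                  (w * m ^ t) (D ^ t) (c * length ys ^ t) ys ys≢[] averaged
        cs , r = dependent-choice t (filter (λ x → R? x y) xs) (filter (λ z → S? z y) zs)
                   (All.filter⁺ (λ x → R? x y) dR) (All.filter⁺ (λ z → S? z y) dS) q
    in y ∷ cs , (begin
      w * count (λ z → all? (S? z) (y ∷ cs)) zs + c
        ≡⟨ cong (λ l → w * l + c) (count-all-∷ S? y cs zs) ⟩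
      w * count (λ z → all? (S? z) cs) (filter (λ z → S? z y) zs) + c
        ≤⟨ r ⟩
      count (λ x → all? (R? x) cs) (filter (λ x → R? x y) xs)
        ≡⟨ count-all-∷ R? y cs xs ⟨
      count (λ x → all? (R? x) (y ∷ cs)) xs ∎)
    where
    open ≤-Reasoning
    M = length ys
    regroup₁ : ∀ w mt z m c M Mt → w * mt * (z * m) + M * (c * Mt) ≡ w * (m * mt) * z + c * (M * Mt)
    regroup₁ = solve-∀
    regroup₂ : ∀ D Dt x → D * Dt * x ≡ Dt * (x * D)
    regroup₂ = solve-∀
    averaged : w * m ^ t * sum (map (λ y → count (λ z → S? z y) zs) ys) + M * (c * M ^ t)
             ≤ D ^ t * sum (map (λ y → count (λ x → R? x y) xs) ys)
    averaged = begin
      w * m ^ t * sum (map (λ y → count (λ z → S? z y) zs) ys) + M * (c * M ^ t)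
        ≡⟨ cong (λ l → w * m ^ t * l + M * (c * M ^ t)) (double-count S? zs ys) ⟩
      w * m ^ t * sum (map (λ z → count (S? z) ys) zs) + M * (c * M ^ t)
        ≤⟨ +-monoˡ-≤ _ (*-monoʳ-≤ (w * m ^ t) (sum-≤ _ zs dS)) ⟩
      w * m ^ t * (length zs * m) + M * (c * M ^ t)
        ≡⟨ regroup₁ w (m ^ t) (length zs) m c M (M ^ t) ⟩
      w * m ^ suc t * length zs + c * M ^ suc t
        ≤⟨ le ⟩
      D ^ suc t * length xs
        ≡⟨ regroup₂ D (D ^ t) (length xs) ⟩
      D ^ t * (length xs * D)
        ≤⟨ *-monoʳ-≤ (D ^ t) (sum-≥ _ xs dR) ⟩
      D ^ t * sum (map (λ x → count (R? x) ys) xs)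
        ≡⟨ cong (D ^ t *_) (double-count R? xs ys) ⟨
      D ^ t * sum (map (λ y → count (λ x → R? x y) xs) ys) ∎

-- Ordered tuples with repetition stand in for `k`-subsets: their number is exactly a power, and
-- every `k`-subset appears among them.
tuples : ℕ → List X → List (List X)
tuples zero    xs = [] ∷ []
tuples (suc k) xs = cartesianProductWith _∷_ xs (tuples k xs)

length-cartesianProductWith : ∀ (f : X → Y → Z) xs ys →
  length (cartesianProductWith f xs ys) ≡ length xs * length ys
length-cartesianProductWith f []       ys = refl
length-cartesianProductWith f (x ∷ xs) ys = trans (length-++ (map (f x) ys))
  (cong₂ _+_ (length-map (f x) ys) (length-cartesianProductWith f xs ys))

length-tuples : ∀ k (xs : List X) → length (tuples k xs) ≡ length xs ^ k
length-tuples zero    xs = refl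
length-tuples (suc k) xs = trans (length-cartesianProductWith _∷_ xs (tuples k xs))
                                 (cong (length xs *_) (length-tuples k xs))

∈-tuples : ∀ {xs : List X} zs → zs ⊆ xs → zs ∈ tuples (length zs) xs
∈-tuples []       sub = here refl
∈-tuples (z ∷ zs) sub = ∈-cartesianProductWith⁺ _∷_ (sub (here refl)) (∈-tuples zs (sub ∘ there))

module _ {R : REL X Y 0ℓ} (R? : B.Decidable R) where

  common? : (zs : List X) → Decidable (λ y → All (λ z → R z y) zs)
  common? zs y = all? (λ z → R? z y) zs

  -- A tuple with few common neighbours gets the weight |xs|, so that a subset of xs
  -- containing one would have to be larger than xs itself.
  rich-subset : ∀ k t {D m c} xs ys → 0 < length ys → 0 < c →
    All (λ x → D ≤ count (R? x) ys) xs → Unique xs →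
    length xs * m ^ t * length xs ^ k + c * length ys ^ t ≤ D ^ t * length xs →
    ∃ λ xs′ → xs′ ⊆ xs × Unique xs′ × c ≤ length xs′ ×
      (∀ zs → length zs ≡ k → zs ⊆ xs′ → m < count (common? zs) ys)
  rich-subset k t {D} {m} {c} xs ys ys≢[] c>0 deg uniq le =
    let cs , q = dependent-choice R? common? ys ys≢[] D m (length xs) c t xs bad
                   deg (All.all-filter poor? (tuples k xs)) bound
        kept? = λ x → all? (R? x) cs
        rich : ∀ zs → length zs ≡ k → zs ⊆ filter kept? xs → m < count (common? zs) ys
        rich zs len sub = ≰⇒> λ poor →
          let zs∈tuples = subst (λ j → zs ∈ tuples j xs) len (∈-tuples zs (filter-⊆ kept? xs ∘ sub))
              -- Entries of `zs` survived the filter, so each is adjacent to all samples. Hence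
              -- every sample is a common neighbour of `zs`, and `zs` itself is a surviving poor
              -- tuple.
              adjacent = All.tabulate λ y∈cs → All.tabulate λ z∈zs →
                           All.lookup (proj₂ (∈-filter⁻ kept? {xs = xs} (sub z∈zs))) y∈cs
              survives = ∈-filter⁺ (λ z → all? (common? z) cs)
                           (∈-filter⁺ poor? zs∈tuples poor) adjacent
          in <-irrefl refl (begin-strict
            length xs                       ≡⟨ *-identityʳ _ ⟨
            length xs * 1                   <⟨ m<m+n (length xs * 1) c>0 ⟩
            length xs * 1 + c               ≤⟨ +-monoˡ-≤ c (*-monoʳ-≤ (length xs) (∈-length survives)) ⟩
            length xs * count (λ z → all? (common? z) cs) bad + c ≤⟨ q ⟩
            count kept? xs                  ≤⟨ length-filter kept? xs ⟩
            length xs                       ∎)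
    in filter kept? xs , filter-⊆ kept? xs , Unique.filter⁺ kept? uniq , ≤-trans (m≤n+m c _) q , rich
    where
    open ≤-Reasoning
    poor? : Decidable (λ zs → count (common? zs) ys ≤ m)
    poor? zs = count (common? zs) ys ≤? m
    bad = filter poor? (tuples k xs)
    bound : length xs * m ^ t * length bad + c * length ys ^ t ≤ D ^ t * length xs
    bound = ≤-trans (+-monoˡ-≤ _ (*-monoʳ-≤ (length xs * m ^ t)
      (≤-trans (length-filter poor? (tuples k xs)) (≤-reflexive (length-tuples k xs))))) le

-- Splitting, indexing and prefixes of lists.

AllPairs-++⁻ : ∀ {R : X → X → Set} xs {ys} → AllPairs R (xs ++ ys) →
  AllPairs R xs × AllPairs R ys × All (λ x → All (R x) ys) xs
AllPairs-++⁻ []       rs       = [] , rs , []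
AllPairs-++⁻ (x ∷ xs) (r ∷ rs) =
  let rxs , rys = All.++⁻ xs r
      p , q , s = AllPairs-++⁻ xs rs
  in rxs ∷ p , q , rys ∷ s

lookup-injective : ∀ {xs : List X} → Unique xs → Injective _≡_ _≡_ (lookup xs)
lookup-injective (_ ∷ _) {zero}  {zero}  _  = refl
lookup-injective {xs = _ ∷ xs} (p ∷ _) {zero} {suc j} eq = contradiction eq (All.lookup p (∈-lookup j))
lookup-injective {xs = _ ∷ xs} (p ∷ _) {suc i} {zero} eq = contradiction (sym eq) (All.lookup p (∈-lookup i))
lookup-injective (_ ∷ u) {suc i} {suc j} eq = cong suc (lookup-injective u eq)

take-length-++ : ∀ (xs : List X) {ys} → take (length xs) (xs ++ ys) ≡ xs
take-length-++ []       = refl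
take-length-++ (x ∷ xs) = cong (x ∷_) (take-length-++ xs)

take-⊆ : ∀ n (xs : List X) → take n xs ⊆ xs
take-⊆ n xs = subst (_ ∈_) (take++drop≡id n xs) ∘ ∈-++⁺ˡ

All-take-++ : ∀ {P : Pred X 0ℓ} n xs {ys} → All P xs → All P (take n ys) → All P (take n (xs ++ ys))
All-take-++ zero    xs       _        _ = []
All-take-++ (suc n) []       _        p = p
All-take-++ (suc n) (x ∷ xs) {ys} (q ∷ qs) p = q ∷ All-take-++ n xs qs (shorten n ys p)
  where
  shorten : ∀ {P : Pred X 0ℓ} n ys → All P (take (suc n) ys) → All P (take n ys)
  shorten zero    _        _        = []
  shorten (suc n) []       _        = []
  shorten (suc n) (y ∷ ys) (p ∷ ps) = p ∷ shorten n ys ps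

-- There are finitely many prefixes, so a constructive search either certifies the median condition
-- at a vertex or returns the prefix behind which that vertex should move.
all-prefixes : ∀ {P : Pred (List X) 0ℓ} → Decidable P → ∀ xs →
  (∀ ys zs → xs ≡ ys ++ zs → P ys) ⊎ (∃ λ ys → ∃ λ zs → xs ≡ ys ++ zs × ¬ P ys)
all-prefixes P? xs with P? []
... | no ¬p = inj₂ ([] , xs , refl , ¬p)
all-prefixes P? [] | yes p = inj₁ λ { [] zs eq → p }
all-prefixes P? (x ∷ xs) | yes p with all-prefixes (P? ∘ (x ∷_)) xs
... | inj₁ ps = inj₁ λ { [] zs eq → p ; (y ∷ ys) zs refl → ps ys zs refl }
... | inj₂ (ys , zs , refl , ¬q) = inj₂ (x ∷ ys , zs , refl , ¬q)

-- Degrees and median orders in a tournament.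

module _ {n : ℕ} (G : Tournament n) where
  open Tournament G

  private
    V = Fin n

    _⟶_ : V → V → Set
    u ⟶ v = T (adj u v)

    _⟶?_ : ∀ u v → _
    u ⟶? v = T? (adj u v)

  outdeg indeg : V → List V → ℕ
  outdeg v xs = count (v ⟶?_) xs
  indeg v xs = count (_⟶? v) xs

  ⟶⇒≢ : ∀ {u v} → u ⟶ v → u ≢ v
  ⟶⇒≢ {u} e refl = subst T (irreflexive u) e

  outdeg-++ : ∀ v xs ys → outdeg v (xs ++ ys) ≡ outdeg v xs + outdeg v ys
  outdeg-++ v xs ys = trans (cong length (filter-++ (v ⟶?_) xs ys)) (length-++ (filter (v ⟶?_) xs))

  outdeg-↭ : ∀ v {xs ys} → xs ↭ ys → outdeg v xs ≡ outdeg v ys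
  outdeg-↭ v = ↭-length ∘ filter-↭ (v ⟶?_)

  length≤outdeg+indeg : ∀ v xs → All (v ≢_) xs → length xs ≤ outdeg v xs + indeg v xs
  length≤outdeg+indeg v []       _        = z≤n
  length≤outdeg+indeg v (x ∷ xs) (p ∷ ps) with adj v x | adj x v | complete v x p
  ... | true  | false | _ = s≤s (length≤outdeg+indeg v xs ps)
  ... | true  | true  | _ = s≤s (≤-trans (length≤outdeg+indeg v xs ps) (+-monoʳ-≤ (outdeg v xs) (n≤1+n _)))
  ... | false | true  | _ rewrite +-suc (outdeg v xs) (indeg v xs) = s≤s (length≤outdeg+indeg v xs ps)
  ... | false | false | inj₁ ()
  ... | false | false | inj₂ ()

  -- Records the local property of a median order: each vertex dominates at least half of every
  -- interval that starts right after it. It is reached by local improvement with `forward` as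
  -- potential.
  Median : List V → Set
  Median []       = ⊤
  Median (v ∷ xs) = (∀ ys zs → xs ≡ ys ++ zs → length ys ≤ 2 * outdeg v ys) × Median xs

  forward : List V → ℕ
  forward []       = 0
  forward (v ∷ xs) = outdeg v xs + forward xs

  forward≤ : ∀ xs → forward xs ≤ length xs * length xs
  forward≤ []       = z≤n
  forward≤ (v ∷ xs) = begin
    outdeg v xs + forward xs                           ≤⟨ +-mono-≤ (length-filter (v ⟶?_) xs) (forward≤ xs) ⟩
    length xs + length xs * length xs               ≡⟨⟩
    suc (length xs) * length xs                     ≤⟨ *-monoʳ-≤ (suc (length xs)) (n≤1+n _) ⟩
    suc (length xs) * suc (length xs)               ∎
    where open ≤-Reasoning

  -- The forward arcs at `v` come from `ys` into `v` and go from `v` into `zs`; arcs avoiding `v`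
  -- keep their direction.
  forward-insert : ∀ v ys zs → forward (ys ++ v ∷ zs) ≡ indeg v ys + outdeg v zs + forward (ys ++ zs)
  forward-insert v []       zs = refl
  forward-insert v (y ∷ ys) zs
    rewrite forward-insert v ys zs | outdeg-++ y ys (v ∷ zs) | outdeg-++ y ys zs
    with adj y v
  ... | true  = arith (outdeg y ys) (outdeg y zs) (indeg v ys) (outdeg v zs) (forward (ys ++ zs))
    where
    arith : ∀ a b c d e → a + suc b + (c + d + e) ≡ suc (c + d + (a + b + e))
    arith = solve-∀
  ... | false = arith (outdeg y ys) (outdeg y zs) (indeg v ys) (outdeg v zs) (forward (ys ++ zs))
    where
    arith : ∀ a b c d e → a + b + (c + d + e) ≡ c + d + (a + b + e)
    arith = solve-∀

  -- Moving a vertex behind a prefix in which it has more in- than out-neighbours gains forward arcs.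
  improve : ∀ xs → Unique xs → Median xs ⊎ (∃ λ ys → ys ↭ xs × forward xs < forward ys)
  improve []       _        = inj₁ tt
  improve (v ∷ xs) (v∉ ∷ u) with all-prefixes (λ ys → length ys ≤? 2 * outdeg v ys) xs | improve xs u
  ... | inj₁ ps | inj₁ m = inj₁ (ps , m)
  ... | inj₁ _  | inj₂ (ys , ys↭xs , lt) = inj₂ (v ∷ ys , prep v ys↭xs , (begin-strict
    outdeg v xs + forward xs  ≡⟨ cong (_+ forward xs) (outdeg-↭ v ys↭xs) ⟨
    outdeg v ys + forward xs  <⟨ +-monoʳ-< (outdeg v ys) lt ⟩
    outdeg v ys + forward ys  ∎))
    where open ≤-Reasoning
  ... | inj₂ (ys , zs , refl , ¬half) | _ = inj₂ (ys ++ v ∷ zs , shift v ys zs , (begin-strict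
    outdeg v (ys ++ zs) + forward (ys ++ zs)        ≡⟨ cong (_+ forward (ys ++ zs)) (outdeg-++ v ys zs) ⟩
    outdeg v ys + outdeg v zs + forward (ys ++ zs)     <⟨ +-monoˡ-< _ (+-monoˡ-< (outdeg v zs) outdeg<indeg) ⟩
    indeg v ys + outdeg v zs + forward (ys ++ zs)     ≡⟨ forward-insert v ys zs ⟨
    forward (ys ++ v ∷ zs)                       ∎))
    where
    open ≤-Reasoning
    outdeg<indeg : outdeg v ys < indeg v ys
    outdeg<indeg = +-cancelˡ-< (outdeg v ys) _ _ (begin-strict
      outdeg v ys + outdeg v ys  ≡⟨ cong (outdeg v ys +_) (+-identityʳ _) ⟨
      2 * outdeg v ys         <⟨ ≰⇒> ¬half ⟩
      length ys            ≤⟨ length≤outdeg+indeg v ys (proj₁ (All.++⁻ ys v∉)) ⟩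
      outdeg v ys + indeg v ys  ∎)

  Unique-↭ : ∀ {xs ys : List V} → xs ↭ ys → Unique xs → Unique ys
  Unique-↭ = Permutationₛ.Unique-resp-↭ (setoid V) ∘ ↭⇒↭ₛ

  -- The fuel bounds the gap between `forward` and its upper bound from `forward≤`. Each improvement
  -- narrows this gap, so an improvement with no fuel left is impossible.
  median-order : ∀ fuel xs → Unique xs → length xs * length xs ≤ fuel + forward xs →
    ∃ λ ys → ys ↭ xs × Median ys
  median-order fuel xs u le with improve xs u
  ... | inj₁ m = xs , ↭-refl , m
  median-order zero xs u le | inj₂ (ys , ys↭xs , lt) = contradiction (begin-strict
    length xs * length xs  ≤⟨ le ⟩
    forward xs             <⟨ lt ⟩
    forward ys             ≤⟨ forward≤ ys ⟩
    length ys * length ys  ≡⟨ cong (λ l → l * l) (↭-length ys↭xs) ⟩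
    length xs * length xs  ∎) (<-irrefl refl)
    where open ≤-Reasoning
  median-order (suc fuel) xs u le | inj₂ (ys , ys↭xs , lt) =
    let zs , zs↭ys , m = median-order fuel ys (Unique-↭ (↭-sym ys↭xs) u) (begin
          length ys * length ys  ≡⟨ cong (λ l → l * l) (↭-length ys↭xs) ⟩
          length xs * length xs  ≤⟨ le ⟩
          suc fuel + forward xs  ≡⟨ +-suc fuel (forward xs) ⟨
          fuel + suc (forward xs) ≤⟨ +-monoʳ-≤ fuel lt ⟩
          fuel + forward ys      ∎)
    in zs , ↭-trans zs↭ys ys↭xs , m
    where open ≤-Reasoning

  Median-++⁻ʳ : ∀ xs {ys} → Median (xs ++ ys) → Median ys
  Median-++⁻ʳ []       m       = m
  Median-++⁻ʳ (_ ∷ xs) (_ , m) = Median-++⁻ʳ xs m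

  -- The half condition is applied to the interval from just after `v` to the end of `ys`. At worst
  -- `v` dominates all of the part inside `xs`, which costs at most `length xs`.
  Median-outdeg : ∀ {v} xs ys {zs} → Median (xs ++ ys ++ zs) → v ∈ xs →
    length ys ≤ length xs + 2 * outdeg v ys
  Median-outdeg (v ∷ xs) ys {zs} (half , _) (here refl) = +-cancelˡ-≤ (length xs) _ _ (begin
    length xs + length ys                ≡⟨ length-++ xs ⟨
    length (xs ++ ys)                    ≤⟨ half (xs ++ ys) zs (sym (++-assoc xs ys zs)) ⟩
    2 * outdeg v (xs ++ ys)                 ≡⟨ cong (2 *_) (outdeg-++ v xs ys) ⟩
    2 * (outdeg v xs + outdeg v ys)            ≤⟨ *-monoʳ-≤ 2 (+-monoˡ-≤ (outdeg v ys) (length-filter (v ⟶?_) xs)) ⟩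
    2 * (length xs + outdeg v ys)           ≡⟨ regroup (length xs) (outdeg v ys) ⟩
    length xs + (length xs + 2 * outdeg v ys) ≤⟨ +-monoʳ-≤ (length xs) (n≤1+n _) ⟩
    length xs + suc (length xs + 2 * outdeg v ys) ∎)
    where
    open ≤-Reasoning
    regroup : ∀ l o → 2 * (l + o) ≡ l + (l + 2 * o)
    regroup = solve-∀
  Median-outdeg (_ ∷ xs) ys (_ , m) (there v∈xs) = m≤n⇒m≤1+n (Median-outdeg xs ys m v∈xs)

  -- Transitive subtournaments and powers of paths.

  transitive-subset : ∀ k xs → Unique xs → 2 ^ k ≤ length xs →
    ∃ λ S → length S ≡ k × AllPairs _⟶_ S × S ⊆ xs
  transitive-subset zero    xs       _        _  = [] , refl , [] , λ ()
  transitive-subset (suc k) []       _        le = contradiction le (<⇒≱ (m^n>0 2 (suc k)))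
  -- Among the at least `2 ^ (suc k) - 1` other vertices, `v` has `2 ^ k` out-neighbours or `2 ^ k`
  -- in-neighbours. In the first case `v` goes in front of the set found there, in the second behind
  -- it.
  transitive-subset (suc k) (v ∷ xs) (v∉ ∷ u) le with 2 ^ k ≤? outdeg v xs | 2 ^ k ≤? indeg v xs
  ... | yes p | _ =
    let S , len , S⟶ , sub = transitive-subset k _ (Unique.filter⁺ (v ⟶?_) u) p
    in v ∷ S , cong suc len
     , All.tabulate (proj₂ ∘ ∈-filter⁻ (v ⟶?_) {xs = xs} ∘ sub) ∷ S⟶
     , λ { (here refl) → here refl ; (there i) → there (filter-⊆ (v ⟶?_) xs (sub i)) }
  ... | no _ | yes p =
    let S , len , S⟶ , sub = transitive-subset k _ (Unique.filter⁺ (_⟶? v) u) p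
    in S ++ v ∷ [] , trans (length-++ S) (trans (+-comm (length S) 1) (cong suc len))
     , AllPairs.++⁺ S⟶ ([] ∷ [])
         (All.tabulate λ i → proj₂ (∈-filter⁻ (_⟶? v) {xs = xs} (sub i)) ∷ [])
     , [ there ∘ filter-⊆ (_⟶? v) xs ∘ sub , (λ { (here refl) → here refl }) ]′ ∘ ∈-++⁻ S
  ... | no p | no q = contradiction (begin-strict
    2 ^ suc k                          ≤⟨ le ⟩
    suc (length xs)                    ≤⟨ s≤s (length≤outdeg+indeg v xs v∉) ⟩
    suc (outdeg v xs + indeg v xs)          <⟨ ≤-reflexive (cong suc (sym (+-suc (outdeg v xs) _))) ⟩
    suc (outdeg v xs) + suc (indeg v xs)    ≤⟨ +-mono-≤ (≰⇒> p) (≰⇒> q) ⟩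
    2 ^ k + 2 ^ k                      ≡⟨ cong (2 ^ k +_) (+-identityʳ _) ⟨
    2 ^ suc k                          ∎) (<-irrefl refl)
    where open ≤-Reasoning

  -- Each vertex looks ahead `k` places, so that prepending a block concerns only the first `k`
  -- vertices of what follows.
  data PathPower (k : ℕ) : List V → Set where
    []  : PathPower k []
    _∷_ : ∀ {x xs} → All (x ⟶_) (take k xs) → PathPower k xs → PathPower k (x ∷ xs)

  PathPower-++ : ∀ {k} S {P} → AllPairs _⟶_ S → All (λ s → All (s ⟶_) (take k P)) S →
    PathPower k P → PathPower k (S ++ P)
  PathPower-++ []      _          _        p = p
  PathPower-++ {k} (s ∷ S) (s⟶ ∷ S⟶) (q ∷ qs) p = All-take-++ k S s⟶ q ∷ PathPower-++ S S⟶ qs p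

  lookup-PathPower : ∀ {k xs} → PathPower k xs → ∀ i j → toℕ i < toℕ j → toℕ j ≤ toℕ i + k →
    lookup xs i ⟶ lookup xs j
  lookup-PathPower {k} {_ ∷ xs} (p ∷ _) zero (suc j) _ le = lookup-take k xs p j le
    where
    lookup-take : ∀ {P : Pred X 0ℓ} k xs → All P (take k xs) → ∀ i → toℕ i < k → P (lookup xs i)
    lookup-take (suc k) (x ∷ xs) (p ∷ _)  zero    _        = p
    lookup-take (suc k) (x ∷ xs) (_ ∷ ps) (suc i) (s≤s lt) = lookup-take k xs ps i lt
  lookup-PathPower (_ ∷ p) (suc i) (suc j) (s≤s lt) (s≤s le) = lookup-PathPower p i j lt le

  containsPathPower : ∀ {k x xs} → PathPower k (x ∷ xs) → Unique (x ∷ xs) →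
    ContainsPathPower G (length xs) k
  containsPathPower {x = x} {xs} p u = lookup (x ∷ xs) , lookup-injective u , lookup-PathPower p

  -- The walk along the median order.

  module _ (k a D : ℕ) (D>0 : 0 < D) (2^k≤a : 2 ^ k ≤ a)
           -- This is the numerical hypothesis of `rich-subset` with `t = k`, `m = 2 * a`,
           -- `c = 2 ^ k`, `a` vertices and a window of length `4 * D`.
           (budget : a * (2 * a) ^ k * a ^ k + 2 ^ k * (4 * D) ^ k ≤ D ^ k * a) where

    -- The path must start with `k` vertices of `A` because the preceding block dominates `A`;
    -- staying inside `xs` keeps it disjoint from that block.
    LongPath : ℕ → List V → List V → Set
    LongPath s A xs = ∃ λ P → PathPower k P × Unique P × P ⊆ xs × All (_∈ A) (take k P) ×
      length P ≡ suc s * k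

    -- Induction on the number `s` of windows left in `R`. Every window yields one block, and a
    -- final block is taken from the last set `A`.
    long-path : ∀ s C A R → Unique (C ++ R) → Median (C ++ R) → length C ≤ 2 * D →
      A ⊆ C → Unique A → length A ≡ a → s * (4 * D) ≤ length R → LongPath s A (C ++ R)
    -- Treats both halves of the window at once: `C′` is the half holding the next set, and `pre` is
    -- the stretch skipped before it.
    prepend-block : ∀ s C A R pre C′ R′ S → R ≡ pre ++ C′ ++ R′ →
      Unique (C ++ R) → Median (C ++ R) → A ⊆ C →
      length S ≡ k → AllPairs _⟶_ S → S ⊆ A →
      length C′ ≤ 2 * D → a ≤ count (common? _⟶?_ S) C′ → s * (4 * D) ≤ length R′ →
      LongPath (suc s) A (C ++ R)

    long-path zero C A R _ _ _ A⊆C uA lenA _ =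
      let S , len , S⟶ , S⊆A = transitive-subset k A uA (subst (2 ^ k ≤_) (sym lenA) 2^k≤a)
      in S ++ [] , PathPower-++ S S⟶ (All.tabulate λ _ → subst (All _) (sym (take-[] k)) []) []
       , subst Unique (sym (++-identityʳ S)) (AllPairs.map ⟶⇒≢ S⟶)
       , ∈-++⁺ˡ ∘ A⊆C ∘ S⊆A ∘ subst (_ ∈_) (++-identityʳ S)
       , All-take-++ k S (All.tabulate S⊆A) (subst (All _) (sym (take-[] k)) [])
       , trans (cong length (++-identityʳ S)) (trans len (sym (+-identityʳ k)))
    long-path (suc s) C A R uniq med lenC A⊆C uA lenA lenR =
      -- Size `2 ^ k` suffices to extract a transitive `k`-set, and more than `2 * a` common
      -- out-neighbours force `a` of them into one half.
      let X , X⊆A , uX , 2^k≤X , rich = rich-subset _⟶?_ k k {D} {2 * a} {2 ^ k} A (J₁ ++ J₂)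
            (≤-trans (<-≤-trans D>0 (m≤n*m D 4)) (≤-reflexive (sym lenJ))) (m^n>0 2 k)
            (All.tabulate (degree ∘ A⊆C)) uA budget′
          S , lenS , S⟶ , S⊆X = transitive-subset k X uX 2^k≤X
          N = rich S lenS S⊆X
      in [ (λ h → prepend-block s C A R [] J₁ (J₂ ++ R₂) S R≡ uniq med A⊆C lenS S⟶ (X⊆A ∘ S⊆X)
                    (≤-reflexive lenJ₁) h (≤-trans lenR₂ (length-++-≤ʳ R₂ {J₂})))
         , (λ h → prepend-block s C A R J₁ J₂ R₂ S R≡ uniq med A⊆C lenS S⟶ (X⊆A ∘ S⊆X)
                    (≤-reflexive lenJ₂) h lenR₂)
         ]′ (halves (count (common? _⟶?_ S) J₁) _ (subst (2 * a <_)
              (trans (cong length (filter-++ (common? _⟶?_ S) J₁ J₂)) (length-++ (filter (common? _⟶?_ S) J₁))) N))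
      where
      open ≤-Reasoning
      J₁ = take (2 * D) R
      R₁ = drop (2 * D) R
      J₂ = take (2 * D) R₁
      R₂ = drop (2 * D) R₁
      R≡ : R ≡ J₁ ++ J₂ ++ R₂
      R≡ = sym (trans (cong (J₁ ++_) (take++drop≡id (2 * D) R₁)) (take++drop≡id (2 * D) R))
      length-R : s * (4 * D) + 2 * D + 2 * D ≤ length R
      length-R = ≤-trans (≤-reflexive (regroup D (s * (4 * D)))) lenR
        where
        regroup : ∀ d r → r + 2 * d + 2 * d ≡ 4 * d + r
        regroup = solve-∀
      length-R₁ : s * (4 * D) + 2 * D ≤ length R₁
      length-R₁ = subst (s * (4 * D) + 2 * D ≤_) (sym (length-drop (2 * D) R)) (m+n≤o⇒m≤o∸n _ length-R)
      lenR₂ : s * (4 * D) ≤ length R₂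
      lenR₂ = subst (s * (4 * D) ≤_) (sym (length-drop (2 * D) R₁)) (m+n≤o⇒m≤o∸n _ length-R₁)
      lenJ₁ : length J₁ ≡ 2 * D
      lenJ₁ = trans (length-take (2 * D) R) (m≤n⇒m⊓n≡m (m+n≤o⇒n≤o (s * (4 * D) + 2 * D) length-R))
      lenJ₂ : length J₂ ≡ 2 * D
      lenJ₂ = trans (length-take (2 * D) R₁) (m≤n⇒m⊓n≡m (m+n≤o⇒n≤o (s * (4 * D)) length-R₁))
      double : ∀ d → 2 * d + 2 * d ≡ 4 * d
      double = solve-∀
      lenJ : length (J₁ ++ J₂) ≡ 4 * D
      lenJ = trans (length-++ J₁) (trans (cong₂ _+_ lenJ₁ lenJ₂) (double D))
      -- Since `C` has at most `2 * D` vertices and the window has `4 * D`, `Median-outdeg` leaves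
      -- `2 * D` for twice the out-degree.
      degree : ∀ {v} → v ∈ C → D ≤ outdeg v (J₁ ++ J₂)
      degree {v} v∈C = *-cancelˡ-≤ 2 (+-cancelˡ-≤ (2 * D) _ _ (begin
        2 * D + 2 * D                    ≡⟨ double D ⟩
        4 * D                            ≡⟨ lenJ ⟨
        length (J₁ ++ J₂)                ≤⟨ Median-outdeg C (J₁ ++ J₂) (subst (λ r → Median (C ++ r))
                                              (trans R≡ (sym (++-assoc J₁ J₂ R₂))) med) v∈C ⟩
        length C + 2 * outdeg v (J₁ ++ J₂)  ≤⟨ +-monoˡ-≤ _ lenC ⟩
        2 * D + 2 * outdeg v (J₁ ++ J₂)     ∎))
      budget′ : length A * (2 * a) ^ k * length A ^ k + 2 ^ k * length (J₁ ++ J₂) ^ k ≤ D ^ k * length A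
      budget′ rewrite lenA | lenJ = budget
      halves : ∀ p q → 2 * a < p + q → a ≤ p ⊎ a ≤ q
      halves p q lt with a ≤? p | a ≤? q
      ... | yes h | _     = inj₁ h
      ... | no _  | yes h = inj₂ h
      ... | no h  | no h′ = contradiction (begin-strict
        2 * a   <⟨ lt ⟩
        p + q   ≤⟨ +-mono-≤ (≰⇒≥ h) (≰⇒≥ h′) ⟩
        a + a   ≡⟨ cong (a +_) (+-identityʳ a) ⟨
        2 * a   ∎) (<-irrefl refl)

    prepend-block s C A R pre C′ R′ S refl uniq med A⊆C lenS S⟶ S⊆A lenC′ h lenR′ =
      let _ , uR , C#R = AllPairs-++⁻ C uniq
          _ , uR′ , _  = AllPairs-++⁻ pre uR
          P , pp , uP , P⊆ , start , lenP = long-path s C′ A′ R′ uR′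
            (Median-++⁻ʳ pre (Median-++⁻ʳ C med)) lenC′
            (filter-⊆ common C′ ∘ take-⊆ a _)
            (Unique.take⁺ a (Unique.filter⁺ common (proj₁ (AllPairs-++⁻ C′ uR′))))
            (trans (length-take a (filter common C′)) (m≤n⇒m⊓n≡m h)) lenR′
      in S ++ P
       -- By `start`, the first `k` vertices of `P` lie in `A′`, hence are common out-neighbours of
       -- the block `S`.
       , PathPower-++ S S⟶ (All.tabulate λ s∈S → All.map (λ x∈A′ →
           All.lookup (proj₂ (∈-filter⁻ common {xs = C′} (take-⊆ a _ x∈A′))) s∈S) start) pp
       , AllPairs.++⁺ (AllPairs.map ⟶⇒≢ S⟶) uP (All.tabulate λ s∈S → All.tabulate λ x∈P →
           All.lookup (All.lookup C#R (A⊆C (S⊆A s∈S))) (∈-++⁺ʳ pre (P⊆ x∈P)))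
       , [ ∈-++⁺ˡ ∘ A⊆C ∘ S⊆A , ∈-++⁺ʳ C ∘ ∈-++⁺ʳ pre ∘ P⊆ ]′ ∘ ∈-++⁻ S
       -- As `S` has exactly `k` vertices, the new path starts with `S` itself, which lies in `A`.
       , subst (All (_∈ A)) (sym (subst (λ j → take j (S ++ P) ≡ S) lenS (take-length-++ S))) (All.tabulate S⊆A)
       , trans (length-++ S) (cong₂ _+_ lenS lenP)
      where
      common = common? _⟶?_ S
      A′ = take a (filter common C′)

-- Choice of the parameters and the final count.

^-distribʳ-* : ∀ m n k → (m * n) ^ k ≡ m ^ k * n ^ k
^-distribʳ-* m n zero    = refl
^-distribʳ-* m n (suc k) = trans (cong (m * n *_) (^-distribʳ-* m n k)) (interchange m n (m ^ k) (n ^ k))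
  where
  interchange : ∀ a b c d → a * b * (c * d) ≡ a * c * (b * d)
  interchange = solve-∀

module Parameters (k : ℕ) where
  a D : ℕ
  a = 2 * 8 ^ k
  D = 2 * (2 * a * a)

  a>0 : 0 < a
  a>0 = *-monoʳ-< 2 (m^n>0 8 k)

  D>0 : 0 < D
  D>0 = *-monoʳ-< 2 (*-mono-< (*-monoʳ-< 2 a>0) a>0)

  2^k≤a : 2 ^ k ≤ a
  2^k≤a = ≤-trans (^-monoˡ-≤ k (s≤s (s≤s z≤n))) (m≤n*m (8 ^ k) 2)

  a≤2D : a ≤ 2 * D
  a≤2D = begin
    a            ≤⟨ m≤m*n a a {{>-nonZero a>0}} ⟩
    a * a        ≤⟨ m≤n*m (a * a) 8 ⟩
    8 * (a * a)  ≡⟨ regroup a ⟩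
    2 * D        ∎
    where
    open ≤-Reasoning
    regroup : ∀ a → 8 * (a * a) ≡ 2 * (2 * (2 * a * a))
    regroup = solve-∀

  a≤4D : a ≤ 4 * D
  a≤4D = ≤-trans a≤2D (*-monoˡ-≤ D {2} {4} (s≤s (s≤s z≤n)))

  -- Twice the window length is `32 * a * a`, that is, 128 times the `k`-th power of 64. The factor
  -- 2 pays for the boundary losses in the final count.
  8D : 4 * D * 2 ≡ 2 ^ (6 * k + 7)
  8D = trans (regroup (8 ^ k)) (trans (cong (_* 128) power) (sym (^-distribˡ-+-* 2 (6 * k) 7)))
    where
    regroup : ∀ e → 4 * (2 * (2 * (2 * e) * (2 * e))) * 2 ≡ e * e * 128
    regroup = solve-∀
    power : 8 ^ k * 8 ^ k ≡ 2 ^ (6 * k)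
    power = trans (sym (^-distribʳ-* 8 8 k)) (^-*-assoc 2 6 k)

  -- With `Q = 2 * a * a` we have `D = 2 * Q` and `4 * D = 8 * Q`. The choice of `a` makes the
  -- second summand exactly half of the right side, and the first is at most the other half because
  -- `2 ≤ 2 ^ k`.
  budget : 1 ≤ k → a * (2 * a) ^ k * a ^ k + 2 ^ k * (4 * D) ^ k ≤ D ^ k * a
  budget 1≤k = begin
    a * (2 * a) ^ k * a ^ k + 2 ^ k * (4 * D) ^ k
      ≡⟨ cong₂ _+_ (trans (*-assoc a _ _) (cong (a *_) (sym (^-distribʳ-* (2 * a) a k))))
                   (cong (2 ^ k *_) (trans (cong (_^ k) (quad Q)) (^-distribʳ-* 8 Q k))) ⟩
    2 * e * Q ^ k + t * (e * Q ^ k)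
      ≤⟨ +-monoˡ-≤ _ (*-monoˡ-≤ (Q ^ k) (*-monoˡ-≤ e (^-monoʳ-≤ 2 1≤k))) ⟩
    t * e * Q ^ k + t * (e * Q ^ k)
      ≡⟨ collect t e (Q ^ k) ⟩
    t * Q ^ k * (2 * e)
      ≡⟨ cong (_* a) (^-distribʳ-* 2 Q k) ⟨
    D ^ k * a ∎
    where
    open ≤-Reasoning
    Q = 2 * a * a
    e = 8 ^ k
    t = 2 ^ k
    quad : ∀ q → 4 * (2 * q) ≡ 8 * q
    quad = solve-∀
    collect : ∀ t e q → t * e * q + t * (e * q) ≡ t * q * (2 * e)
    collect = solve-∀

theorem1 : (n k : ℕ) → 2 ≤ n → 2 ≤ k → (G : Tournament n) →
    Σ ℕ (λ ℓ → n ≤ ℓ * 2 ^ (6 * k + 7) × ContainsPathPower G ℓ k)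
theorem1 n k 2≤n 2≤k G with Parameters.a k ≤? n
theorem1 (suc zero) _ (s≤s ()) _ _ | no _
-- For `n` below `a` the bound asks for at most `ℓ = 1`, so a single edge is enough.
theorem1 (suc (suc n)) k _ 2≤k G | no a≰n = 1 , n≤ , edge (complete zero (suc zero) λ ())
  where
  open Parameters k
  open Tournament G
  open ≤-Reasoning
  n≤ : suc (suc n) ≤ 1 * 2 ^ (6 * k + 7)
  n≤ = begin
    suc (suc n)          ≤⟨ ≰⇒≥ a≰n ⟩
    a                    ≤⟨ a≤4D ⟩
    4 * D                ≤⟨ m≤m*n (4 * D) 2 ⟩
    4 * D * 2            ≡⟨ 8D ⟩
    2 ^ (6 * k + 7)      ≡⟨ *-identityˡ _ ⟨
    1 * 2 ^ (6 * k + 7)  ∎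
  path : ∀ {u v} → T (adj u v) → ContainsPathPower G 1 k
  path e = containsPathPower G (All.take⁺ k (e ∷ []) ∷ (subst (All _) (sym (take-[] k)) [] ∷ []))
                               ((⟶⇒≢ G e ∷ []) ∷ [] ∷ [])
  edge : T (adj zero (suc zero)) ⊎ T (adj (suc zero) zero) → ContainsPathPower G 1 k
  edge = [ path , path ]′
theorem1 n k _ 2≤k G | yes a≤n =
  let xs , xs↭ , med = median-order G (n * n) (allFin n) (Unique.allFin⁺ n)
        (≤-trans (≤-reflexive (cong₂ _*_ length-allFin length-allFin)) (m≤m+n (n * n) _))
      len : length xs ≡ n
      len = trans (↭-length xs↭) length-allFin
      R = drop a xs
      s = length R / (4 * D)
      lenC = trans (length-take a xs) (m≤n⇒m⊓n≡m (subst (a ≤_) (sym len) a≤n))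
      -- The walk starts with the first `a` vertices of the order as both the interval and the set
      -- `A`.
      P , pp , uP , _ , _ , lenP = long-path G k a D D>0 2^k≤a (budget (<⇒≤ 2≤k)) s (take a xs) (take a xs) R
        (subst Unique (sym (take++drop≡id a xs)) (Unique-↭ G (↭-sym xs↭) (Unique.allFin⁺ n)))
        (subst (Median G) (sym (take++drop≡id a xs)) med)
        (≤-trans (≤-reflexive lenC) a≤2D)
        (λ i → i) (Unique.take⁺ a (Unique-↭ G (↭-sym xs↭) (Unique.allFin⁺ n))) lenC (m/n*n≤m (length R) (4 * D))
      -- Besides the `s` full windows, the initial interval and the incomplete last window each
      -- count as one more.
      n≤ : n ≤ suc (suc s) * (4 * D)
      n≤ = begin
        n                                      ≡⟨ len ⟨
        length xs                              ≡⟨ cong length (take++drop≡id a xs) ⟨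
        length (take a xs ++ R)                ≡⟨ length-++ (take a xs) ⟩
        length (take a xs) + length R          ≡⟨ cong (_+ length R) lenC ⟩
        a + length R                           ≡⟨ cong (a +_) (m≡m%n+[m/n]*n (length R) (4 * D)) ⟩
        a + (length R % (4 * D) + s * (4 * D)) ≤⟨ +-mono-≤ a≤4D (+-monoˡ-≤ _ (<⇒≤ (m%n<n (length R) (4 * D)))) ⟩
        suc (suc s) * (4 * D)                  ∎
  in conclude s P pp uP lenP n≤
  where
  open Parameters k
  open ≤-Reasoning
  instance
    4D≢0 = >-nonZero (*-monoʳ-< 4 D>0)
  length-allFin : length (allFin n) ≡ n
  length-allFin = length-tabulate {n = n} λ i → i
  conclude : ∀ s P → PathPower G k P → Unique P → length P ≡ suc s * k → n ≤ suc (suc s) * (4 * D) →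
    Σ ℕ (λ ℓ → n ≤ ℓ * 2 ^ (6 * k + 7) × ContainsPathPower G ℓ k)
  conclude s []       _  _  lenP _  = contradiction (begin-strict
    0          <⟨ <⇒≤ 2≤k ⟩
    k          ≤⟨ m≤n*m k (suc s) ⟩
    suc s * k  ≡⟨ lenP ⟨
    0          ∎) (<-irrefl refl)
  conclude s (x ∷ xs) pp uP lenP n≤ = length xs , (begin
    n                                ≤⟨ n≤ ⟩
    suc (suc s) * (4 * D)            ≤⟨ *-monoˡ-≤ (4 * D) blocks ⟩
    length xs * 2 * (4 * D)          ≡⟨ *-assoc (length xs) 2 _ ⟩
    length xs * (2 * (4 * D))        ≡⟨ cong (length xs *_) (trans (*-comm 2 (4 * D)) 8D) ⟩
    length xs * 2 ^ (6 * k + 7)      ∎) , containsPathPower G pp uP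
    where
    -- Here `ℓ = length xs` is one less than the number `suc s * k` of vertices. From `2 ≤ k` this
    -- gives `suc s ≤ ℓ`, and doubling covers the extra window.
    blocks : suc (suc s) ≤ length xs * 2
    blocks = begin
      suc (suc s)        ≤⟨ s≤s (s≤s (m≤m*n s 2)) ⟩
      suc s * 2          ≤⟨ *-monoˡ-≤ 2 (+-cancelˡ-≤ 1 _ _ (begin
        suc (suc s)        ≤⟨ s≤s (s≤s (m≤m*n s 2)) ⟩
        suc s * 2          ≤⟨ *-monoʳ-≤ (suc s) 2≤k ⟩
        suc s * k          ≡⟨ lenP ⟨
        suc (length xs)    ∎)) ⟩
      length xs * 2      ∎
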